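{- Let $c, r$ be positive integers. Call a set of squares of an $m \times n$ grid a valid $(c,r)$-tree configuration if every column contains exactly $c$ of the chosen squares (trees), every row contains exactly $r$ trees, and no two trees are in squares adjacent horizontally, vertically, or diagonally. Then: (i) if a valid $(c,r)$-tree configuration exists on an $m \times n$ grid with $(m,n) \neq (1,1)$, then $m \ge 4c$ and $n \ge 4r$ (the $1 \times 1$ grid admits one only when $c=r=1$); (ii) the $4c \times 4r$ grid admits exactly two valid $(c,r)$-tree configurations. Index rows $1,\dots,4c$ from top and columns $1,\dots,4r$ from left. These configurations are the following. The first has trees at $(2i-1,2j)$ for $1\le i\le c,\ 1\le j\le r$; at $(2i,2j)$ for $1\le i\le c,\ r<j\le 2r$; at $(2i-1,2j-1)$ for $c<i\le 2c,\ 1\le j\le r$; and at $(2i,2j-1)$ for $c<i\le 2c,\ r<j\le 2r$. The second is the image of the first under the row reflection $(k,\ell)\mapsto(4c+1-k,\ell)$.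
   Context: A valid configuration of trees for a $(c,r)$-tree Parks puzzle on an $m\times n$ grid is a set of squares satisfying the column, row and non-adjacency conditions stated in the claim. The paper calls the two configurations on the $4c\times 4r$ grid "Shuriken arrangements". Equivalently: divide the $4c\times 4r$ grid into $2\times 2$ boxes and into four quadrants of size $2c \times 2r$. Within each quadrant every box has its tree in the same position. In the first arrangement this position is the top-right cell of the box in the upper-left quadrant, the bottom-right cell in the upper-right quadrant, the top-left cell in the lower-left quadrant, and the bottom-left cell in the lower-right quadrant. -}

module Defs where

open import Data.Nat using (ℕ; suc; _*_; _∸_; _≤_; _<_; ∣_-_∣)
open import Data.Fin using (Fin; toℕ; opposite)
open import Data.Fin.Subset using (Subset; _∈_; ∣_∣)
open import Data.Vec using (Vec; lookup; map; tabulate)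
open import Function.Bundles using (_⇔_)
open import Relation.Binary.PropositionalEquality using (_≡_)
open import Relation.Nullary using (¬_)

-- A set of squares of the grid with m rows and n columns, stored row by row
-- (row zero at the top, column zero at the left).
Configuration : ℕ → ℕ → Set
Configuration m n = Vec (Subset n) m

row : ∀ {m n} → Configuration m n → Fin m → Subset n
row A k = lookup A k

column : ∀ {m n} → Configuration m n → Fin n → Subset m
column A l = map (λ R → lookup R l) A

Tree : ∀ {m n} → Configuration m n → Fin m → Fin n → Set
Tree A k l = l ∈ row A k

data Adjacent {m n : ℕ} (k : Fin m) (l : Fin n) (k′ : Fin m) (l′ : Fin n) : Set where
  horizontally : k ≡ k′ → ∣ toℕ l - toℕ l′ ∣ ≡ 1 → Adjacent k l k′ l′
  vertically   : ∣ toℕ k - toℕ k′ ∣ ≡ 1 → l ≡ l′ → Adjacent k l k′ l′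
  diagonally   : ∣ toℕ k - toℕ k′ ∣ ≡ 1 → ∣ toℕ l - toℕ l′ ∣ ≡ 1 → Adjacent k l k′ l′

record Valid (c r : ℕ) {m n : ℕ} (A : Configuration m n) : Set where
  field
    columns     : ∀ l → ∣ column A l ∣ ≡ c
    rows        : ∀ k → ∣ row A k ∣ ≡ r
    nonAdjacent : ∀ {k l k′ l′} → Tree A k l → Tree A k′ l′ → ¬ Adjacent k l k′ l′

-- The squares (k , l) of the first Shuriken arrangement; here k and l are
-- 1-based.  In every constructor i ≥ 1 and j ≥ 1, so ∸ is true subtraction.
data ShurikenSquare (c r : ℕ) (k l : ℕ) : Set where
  upperLeft  : ∀ i j → 1 ≤ i → i ≤ c → 1 ≤ j → j ≤ r →
               k ≡ 2 * i ∸ 1 → l ≡ 2 * j → ShurikenSquare c r k l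
  upperRight : ∀ i j → 1 ≤ i → i ≤ c → r < j → j ≤ 2 * r →
               k ≡ 2 * i → l ≡ 2 * j → ShurikenSquare c r k l
  lowerLeft  : ∀ i j → c < i → i ≤ 2 * c → 1 ≤ j → j ≤ r →
               k ≡ 2 * i ∸ 1 → l ≡ 2 * j ∸ 1 → ShurikenSquare c r k l
  lowerRight : ∀ i j → c < i → i ≤ 2 * c → r < j → j ≤ 2 * r →
               k ≡ 2 * i → l ≡ 2 * j ∸ 1 → ShurikenSquare c r k l

-- This determines A uniquely; suc ∘ toℕ converts indices to 1-based ones.
IsFirstShuriken : (c r : ℕ) → Configuration (4 * c) (4 * r) → Set
IsFirstShuriken c r A =
  ∀ k l → Tree A k l ⇔ ShurikenSquare c r (suc (toℕ k)) (suc (toℕ l))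

-- In 1-based indices opposite is k ↦ m + 1 - k; as it is an involution, this
-- preimage of A is also its image.
reflectRows : ∀ {m n} → Configuration m n → Configuration m n
reflectRows A = tabulate (λ k → row A (opposite k))

{-# OPTIONS --safe #-}

-- Two consecutive rows together hold 2r trees, no two of them in the same or
-- in neighbouring columns, so n ≥ 4r − 1; and n = 4r − 1 would leave the second
-- column empty.  On the 4c × 4r grid this count is tight: every 2 × 2 window
-- starting at an odd row or at an odd column holds exactly one tree.  Hence the
-- vertical position of the tree in a 2 × 2 box depends only on the column of
-- boxes, and the horizontal position only on the row of boxes, which gives two
-- balanced Boolean sequences α and β.  Non-adjacency across the corner of four
-- boxes says that α and β never both have a descent and never both have an
-- ascent, which leaves only two pairs of step functions.
module Submission where

open import Defs
open import Data.Bool using (Bool; true; false; not; _∧_; _∨_; if_then_else_)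
open import Data.Bool.Properties using (∧-comm; ∨-comm; not-involutive)
open import Data.Empty using (⊥-elim)
open import Data.Fin using (Fin; zero; suc; toℕ; opposite; fromℕ<)
open import Data.Fin.Properties using (toℕ-injective; toℕ<n; toℕ-fromℕ<; opposite-prop)
open import Data.Fin.Subset using (Subset; _∈_; ∣_∣)
open import Data.Nat using (ℕ; zero; suc; _+_; _*_; _∸_; _≤_; _<_; _≥_; z≤n; s≤s; s≤s⁻¹; z<s; s<s; s<s⁻¹; _<ᵇ_; ⌊_/2⌋; ∣_-_∣)
open import Data.Nat.Properties
open import Data.Product using (_×_; _,_; ∃-syntax)
open import Data.Sum using (_⊎_; inj₁; inj₂)
open import Data.Vec using (Vec; []; _∷_; there; lookup; tabulate)
open import Data.Vec.Properties using (lookup-map; lookup∘tabulate; tabulate∘lookup; tabulate-cong; lookup⇒[]=; []=⇒lookup)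
open import Function using (_∘_)
open import Function.Bundles using (_⇔_; mk⇔)
open import Relation.Binary.PropositionalEquality using (_≡_; _≢_; refl; sym; trans; cong; cong₂; subst; subst₂; module ≡-Reasoning)
open import Relation.Nullary using (¬_; contradiction; yes; no)

-- Boolean conjunction and negation

∧-false : ∀ {a b} → (a ≡ true → b ≢ true) → a ∧ b ≡ false
∧-false {false}         _ = refl
∧-false {true}  {false} _ = refl
∧-false {true}  {true}  f = ⊥-elim (f refl refl)

not-both : ∀ {a b} → a ∧ b ≡ false → a ≡ true → b ≢ true
not-both () refl refl

∧-trueˡ : ∀ {a b} → a ∧ b ≡ true → a ≡ true
∧-trueˡ {true} _ = refl

∧-trueʳ : ∀ {a b} → a ∧ b ≡ true → b ≡ true
∧-trueʳ {true} e = e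

not-true : ∀ {a} → not a ≡ true → a ≡ false
not-true {false} _ = refl

-- Counting in Boolean sequences

⟦_⟧ : Bool → ℕ
⟦ b ⟧ = if b then 1 else 0

-- Sequences are functions on all of ℕ of which only a prefix is counted, so a shift is composition
-- with `suc` and needs no proof of bounds.
count : ℕ → (ℕ → Bool) → ℕ
count zero    f = 0
count (suc n) f = ⟦ f 0 ⟧ + count n (f ∘ suc)

count-cong : ∀ n {f g} → (∀ {i} → i < n → f i ≡ g i) → count n f ≡ count n g
count-cong zero    e = refl
count-cong (suc n) e = cong₂ _+_ (cong ⟦_⟧ (e z<s)) (count-cong n (e ∘ s<s))

count≤n : ∀ n f → count n f ≤ n
count≤n zero    f = z≤n
count≤n (suc n) f with f 0
... | true  = s≤s (count≤n n (f ∘ suc))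
... | false = m≤n⇒m≤1+n (count≤n n (f ∘ suc))

count-none : ∀ n → count n (λ _ → false) ≡ 0
count-none zero    = refl
count-none (suc n) = count-none n

count-all : ∀ n → count n (λ _ → true) ≡ n
count-all zero    = refl
count-all (suc n) = cong suc (count-all n)

count-not : ∀ n f → count n f + count n (not ∘ f) ≡ n
count-not zero    f = refl
count-not (suc n) f with f 0
... | true  = cong suc (count-not n (f ∘ suc))
... | false = trans (+-suc _ _) (cong suc (count-not n (f ∘ suc)))

count-not-half : ∀ {n f} → count (2 * n) f ≡ n → count (2 * n) (not ∘ f) ≡ n
count-not-half {n} {f} e = +-cancelˡ-≡ n _ _ (begin
  n + count (2 * n) (not ∘ f)              ≡⟨ cong (_+ count (2 * n) (not ∘ f)) (sym e) ⟩
  count (2 * n) f + count (2 * n) (not ∘ f) ≡⟨ count-not (2 * n) f ⟩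
  n + (n + 0)                              ≡⟨ cong (n +_) (+-identityʳ n) ⟩
  n + n                                    ∎)
  where open ≡-Reasoning

count-∨ : ∀ n {f g} → (∀ i → f i ∧ g i ≡ false) →
          count n (λ i → f i ∨ g i) ≡ count n f + count n g
count-∨ zero    e = refl
count-∨ (suc n) {f} {g} e with f 0 | g 0 | e 0
... | true  | false | _ = cong suc (count-∨ n (e ∘ suc))
... | false | true  | _ = trans (cong suc (count-∨ n (e ∘ suc))) (sym (+-suc _ _))
... | false | false | _ = count-∨ n (e ∘ suc)

count-last : ∀ n f → count (suc n) f ≡ ⟦ f n ⟧ + count n f
count-last zero    f = refl
count-last (suc n) f = begin
  ⟦ f 0 ⟧ + count (suc n) (f ∘ suc)           ≡⟨ cong (⟦ f 0 ⟧ +_) (count-last n (f ∘ suc)) ⟩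
  ⟦ f 0 ⟧ + (⟦ f (suc n) ⟧ + count n (f ∘ suc)) ≡⟨ sym (+-assoc ⟦ f 0 ⟧ _ _) ⟩
  ⟦ f 0 ⟧ + ⟦ f (suc n) ⟧ + count n (f ∘ suc)   ≡⟨ cong (_+ count n (f ∘ suc)) (+-comm ⟦ f 0 ⟧ _) ⟩
  ⟦ f (suc n) ⟧ + ⟦ f 0 ⟧ + count n (f ∘ suc)   ≡⟨ +-assoc ⟦ f (suc n) ⟧ _ _ ⟩
  ⟦ f (suc n) ⟧ + (⟦ f 0 ⟧ + count n (f ∘ suc)) ∎
  where open ≡-Reasoning

count-reverse : ∀ n f → count n (λ i → f (n ∸ suc i)) ≡ count n f
count-reverse zero    f = refl
count-reverse (suc n) f =
  trans (cong (⟦ f n ⟧ +_) (count-reverse n f)) (sym (count-last n f))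

count-<ᵇ : ∀ s t → count (s + t) (_<ᵇ s) ≡ s
count-<ᵇ zero    t = count-none t
count-<ᵇ (suc s) t = cong suc (count-<ᵇ s t)

Sparse : (ℕ → Bool) → Set
Sparse f = ∀ i → f i ∧ f (suc i) ≡ false

-- Cut the `q * 2` positions into consecutive pairs; each pair holds at most one `true`.
count-sparse : ∀ q {f} → Sparse f → count (q * 2) f ≤ q
count-sparse zero    s = z≤n
count-sparse (suc q) {f} s with f 0 | f 1 | s 0
... | true  | false | _ = s≤s (count-sparse q (λ i → s (2 + i)))
... | false | true  | _ = s≤s (count-sparse q (λ i → s (2 + i)))
... | false | false | _ = m≤n⇒m≤1+n (count-sparse q (λ i → s (2 + i)))

-- Equality leaves no slack: were one pair empty, the others would have to hold more `true` values
-- than there are pairs.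
count-sparse-tight : ∀ q {f} → Sparse f → count (q * 2) f ≡ q →
                     ∀ {j} → j < q → f (j * 2) ∨ f (suc (j * 2)) ≡ true
count-sparse-tight (suc q) {f} s e {j} j<q with f 0 in e₀ | f 1 in e₁ | s 0
... | false | false | _ = contradiction (≤-trans (≤-reflexive (sym e)) (count-sparse q (λ i → s (2 + i)))) (<-irrefl refl)
count-sparse-tight (suc q) {f} s e {zero}  j<q | true  | false | _ rewrite e₀ = refl
count-sparse-tight (suc q) {f} s e {suc j} j<q | true  | false | _ =
  count-sparse-tight q (λ i → s (2 + i)) (suc-injective e) (s<s⁻¹ j<q)
count-sparse-tight (suc q) {f} s e {zero}  j<q | false | true  | _ rewrite e₀ | e₁ = refl
count-sparse-tight (suc q) {f} s e {suc j} j<q | false | true  | _ =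
  count-sparse-tight q (λ i → s (2 + i)) (suc-injective e) (s<s⁻¹ j<q)

-- Position 0 must be `true`, since the `q * 2` positions after it hold at most `q`; sparsity then
-- clears position 1.
count-sparse-odd-tight : ∀ q {f} → Sparse f → count (suc (q * 2)) f ≡ suc q → f 1 ≡ false
count-sparse-odd-tight q {f} s e with f 0 | s 0
... | true  | s₀ = s₀
... | false | _  = contradiction (≤-trans (≤-reflexive (sym e)) (count-sparse q (s ∘ suc))) (<-irrefl refl)

-- Monotone Boolean sequences

Ascending : ℕ → (ℕ → Bool) → Set
Ascending n f = ∀ {i} → suc i < n → f i ≡ true → f (suc i) ≡ true

ascending-true : ∀ {n f} → Ascending n f → f 0 ≡ true → ∀ {i} → i < n → f i ≡ true
ascending-true a e {zero}  i<n = e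
ascending-true a e {suc i} i<n = a i<n (ascending-true a e (<-trans (n<1+n i) i<n))

-- An ascending sequence is a run of `false` followed by a run of `true`, so its count fixes where
-- it steps. The induction peels off the leading `false` entries.
ascending-step : ∀ s t {n f} → Ascending n f → n ≡ s + t → count n f ≡ t →
                 ∀ {i} → i < n → f i ≡ not (i <ᵇ s)
ascending-step s t {suc n} {f} a n≡ e i<n with f 0 in e₀
ascending-step zero t {suc n} {f} a n≡ e i<n | true = ascending-true a e₀ i<n
-- A `true` at the start would make all `suc n` entries `true`, but `t` is at most `n` here.
ascending-step (suc s) t {suc n} {f} a n≡ e i<n | true =
  contradiction (≤-trans (≤-reflexive t≡) (≤-trans (m≤n+m t s) (≤-reflexive (sym (suc-injective n≡))))) (<-irrefl refl)
  where
  t≡ : suc n ≡ t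
  t≡ = trans (cong suc (sym (trans (count-cong n (ascending-true a e₀ ∘ s<s)) (count-all n)))) e
ascending-step zero t {suc n} {f} a n≡ e i<n | false =
  contradiction (≤-trans (≤-reflexive (trans n≡ (sym e))) (count≤n n (f ∘ suc))) (<-irrefl refl)
ascending-step (suc s) t {suc n} {f} a n≡ e {zero}  i<n | false = e₀
ascending-step (suc s) t {suc n} {f} a n≡ e {suc i} i<n | false =
  ascending-step s t (a ∘ s<s) (suc-injective n≡) e (s<s⁻¹ i<n)

Descent : ℕ → (ℕ → Bool) → Set
Descent n f = ∃[ i ] (suc i < n × f i ≡ true × f (suc i) ≡ false)

-- A failure of monotonicity is returned with its position, which later locates a corner of four
-- boxes.
descent? : ∀ n f → Ascending n f ⊎ Descent n f
descent? zero          f = inj₁ λ ()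
descent? (suc zero)    f = inj₁ λ { (s≤s ()) }
descent? (suc (suc n)) f with descent? (suc n) (f ∘ suc)
... | inj₂ (i , i<n , p , q) = inj₂ (suc i , s<s i<n , p , q)
... | inj₁ a with f 0 in e₀ | f 1 in e₁
...   | true  | false = inj₂ (0 , s<s z<s , e₀ , e₁)
...   | true  | true  = inj₁ λ { {zero} _ _ → e₁ ; {suc i} i<n → a (s<s⁻¹ i<n) }
...   | false | _     = inj₁ λ { {zero} _ p → contradiction (trans (sym e₀) p) λ () ; {suc i} i<n → a (s<s⁻¹ i<n) }

no-descent⇒ascending : ∀ {n f} → ¬ Descent n f → Ascending n f
no-descent⇒ascending {f = f} ¬d {i} i<n p with f (suc i) in e
... | true  = refl
... | false = contradiction (i , i<n , p , e) ¬d

<⇒<ᵇ-true : ∀ {i s} → i < s → (i <ᵇ s) ≡ true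
<⇒<ᵇ-true {zero}  (s≤s _) = refl
<⇒<ᵇ-true {suc i} (s≤s p) = <⇒<ᵇ-true p

≤⇒<ᵇ-false : ∀ {i s} → s ≤ i → (i <ᵇ s) ≡ false
≤⇒<ᵇ-false z≤n     = refl
≤⇒<ᵇ-false (s≤s p) = ≤⇒<ᵇ-false p

<ᵇ-true⇒< : ∀ i s → (i <ᵇ s) ≡ true → i < s
<ᵇ-true⇒< zero    (suc s) _ = z<s
<ᵇ-true⇒< (suc i) (suc s) e = s<s (<ᵇ-true⇒< i s e)

<ᵇ-false⇒≤ : ∀ i s → (i <ᵇ s) ≡ false → s ≤ i
<ᵇ-false⇒≤ i       zero    _ = z≤n
<ᵇ-false⇒≤ (suc i) (suc s) e = s≤s (<ᵇ-false⇒≤ i s e)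

<ᵇ-descent : ∀ s t → 1 ≤ s → 1 ≤ t → Descent (s + t) (_<ᵇ s)
<ᵇ-descent (suc s) (suc t) _ _ =
  s , s<s (m<m+n s z<s) , <⇒<ᵇ-true (n<1+n s) , ≤⇒<ᵇ-false {suc s} ≤-refl

balanced-ascending : ∀ s {f} → Ascending (2 * s) f → count (2 * s) f ≡ s →
                     ∀ {i} → i < 2 * s → f i ≡ not (i <ᵇ s)
balanced-ascending s a = ascending-step s s a (cong (s +_) (+-identityʳ s))

-- Puzzles as Boolean grids

record Parks (c r m n : ℕ) (T : ℕ → ℕ → Bool) : Set where
  field
    columns      : ∀ {l} → l < n → count m (λ k → T k l) ≡ c
    rows         : ∀ {k} → k < m → count n (T k) ≡ r
    horizontal   : ∀ k l → T k l ∧ T k (suc l) ≡ false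
    vertical     : ∀ k l → T k l ∧ T (suc k) l ≡ false
    diagonal     : ∀ k l → T k l ∧ T (suc k) (suc l) ≡ false
    antidiagonal : ∀ k l → T k (suc l) ∧ T (suc k) l ≡ false

-- Lets the arguments about rows serve for columns. Diagonals stay diagonals; the two squares of an
-- antidiagonal change places.
transpose : ∀ {c r m n T} → Parks c r m n T → Parks r c n m (λ l k → T k l)
transpose {T = T} P = record
  { columns      = rows
  ; rows         = columns
  ; horizontal   = λ l k → vertical k l
  ; vertical     = λ l k → horizontal k l
  ; diagonal     = λ l k → diagonal k l
  ; antidiagonal = λ l k → trans (∧-comm (T (suc k) l) _) (antidiagonal k l)
  } where open Parks P

module _ {c r m n T} (P : Parks c r m n T) where
  open Parks P

  rowPair : ℕ → ℕ → Bool
  rowPair k l = T k l ∨ T (suc k) l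

  -- Within two consecutive rows, any square of column `l` is adjacent to any square of column
  -- `suc l`.
  rowPair-sparse : ∀ k → Sparse (rowPair k)
  rowPair-sparse k l
    with T k l | T k (suc l) | T (suc k) l | T (suc k) (suc l)
       | horizontal k l | horizontal (suc k) l | diagonal k l | antidiagonal k l
  ... | true  | false | _     | false | _ | _ | _ | _ = refl
  ... | false | true  | false | _     | _ | _ | _ | _ = refl
  ... | false | false | true  | false | _ | _ | _ | _ = refl
  ... | false | false | false | _     | _ | _ | _ | _ = refl

  -- Vertical non-adjacency makes the two rows disjoint as sets of columns, so their counts add up.
  rowPair-count : ∀ {k} → suc k < m → count n (rowPair k) ≡ 2 * r
  rowPair-count {k} k<m = trans (count-∨ n (vertical k))
    (cong₂ _+_ (rows (<-trans (n<1+n k) k<m)) (trans (rows k<m) (sym (+-identityʳ r))))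

  -- A column of height one that holds `c ≥ 1` trees consists of a tree, so all squares are trees
  -- and a second column would give two neighbours.
  single-row : 1 ≤ c → m ≡ 1 → n ≤ 1
  single-row c≥1 refl with n ≤? 1
  ... | yes n≤1 = n≤1
  ... | no  n≰1 = contradiction (tree (≰⇒> n≰1))
                    (not-both (horizontal 0 0) (tree (<-trans z<s (≰⇒> n≰1))))
    where
    tree : ∀ {l} → l < n → T 0 l ≡ true
    tree {l} l<n with T 0 l | columns l<n
    ... | true  | _    = refl
    ... | false | refl = contradiction c≥1 λ ()

-- The factor 2 stands on the right so that `suc i * 2` computes to `suc (suc (i * 2))`.
data Half : ℕ → Set where
  even : ∀ i → Half (i * 2)
  odd  : ∀ i → Half (suc (i * 2))

half : ∀ n → Half n
half zero    = even 0
half (suc n) with half n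
... | even i = odd i
... | odd  i = even (suc i)

⌊i*2/2⌋≡i : ∀ i → ⌊ i * 2 /2⌋ ≡ i
⌊i*2/2⌋≡i zero    = refl
⌊i*2/2⌋≡i (suc i) = cong suc (⌊i*2/2⌋≡i i)

⌊1+i*2/2⌋≡i : ∀ i → ⌊ suc (i * 2) /2⌋ ≡ i
⌊1+i*2/2⌋≡i zero    = refl
⌊1+i*2/2⌋≡i (suc i) = cong suc (⌊1+i*2/2⌋≡i i)

⌊k/2⌋<p : ∀ {k p} → k < p * 2 → ⌊ k /2⌋ < p
⌊k/2⌋<p {zero}        {suc p} _ = z<s
⌊k/2⌋<p {suc zero}    {suc p} _ = z<s
⌊k/2⌋<p {suc (suc k)} {suc p} l = s<s (⌊k/2⌋<p (s<s⁻¹ (s<s⁻¹ l)))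

i*2<p*2 : ∀ {i p} → i < p → i * 2 < p * 2
i*2<p*2 = *-monoˡ-< 2

1+i*2<p*2 : ∀ {i p} → i < p → suc (i * 2) < p * 2
1+i*2<p*2 = *-monoˡ-≤ 2

4*n≡2*n*2 : ∀ n → 4 * n ≡ 2 * n * 2
4*n≡2*n*2 n = trans (*-assoc 2 2 n) (*-comm 2 (2 * n))

<-4*⇒<-2*2 : ∀ n {k} → k < 4 * n → k < 2 * n * 2
<-4*⇒<-2*2 n {k} = subst (k <_) (4*n≡2*n*2 n)

-- Size bound from two consecutive rows

width-bound : ∀ {c r m n T} → Parks c r m n T → 1 ≤ c → 1 ≤ r → 2 ≤ m → n ≥ 4 * r
width-bound {c} {r} {m} {n} {T} P c≥1 r≥1 m≥2 with half n
... | even q = subst (_≤ q * 2) (sym (4*n≡2*n*2 r))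
                 (*-monoˡ-≤ 2 (subst (_≤ q) (rowPair-count P m≥2) (count-sparse q (rowPair-sparse P 0))))
-- Column 0 adds at most one to the at most `q` occupied columns among the other `q * 2`, so
-- `2 * r ≤ suc q`.
... | odd q with m≤n⇒m<n∨m≡n (subst (_≤ suc q) (rowPair-count P m≥2)
                   (+-mono-≤ (⟦⟧≤1 (rowPair P 0 0)) (count-sparse q (rowPair-sparse P 0 ∘ suc))))
  where
  ⟦⟧≤1 : ∀ b → ⟦ b ⟧ ≤ 1
  ⟦⟧≤1 true  = ≤-refl
  ⟦⟧≤1 false = z≤n
...   | inj₁ (s≤s 2r≤q) = m≤n⇒m≤1+n (subst (_≤ q * 2) (sym (4*n≡2*n*2 r)) (*-monoˡ-≤ 2 2r≤q))
-- Equality means that `n` is 4r - 1. Every pair of consecutive rows is then tight, which empties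
-- column 1 and contradicts `c ≥ 1`.
...   | inj₂ 2r≡1+q = contradiction (subst (1 ≤_) c≡0 c≥1) λ ()
  where
  pair-empty : ∀ {k} → suc k < m → rowPair P k 1 ≡ false
  pair-empty {k} k<m = count-sparse-odd-tight q {rowPair P k} (rowPair-sparse P k) (trans (rowPair-count P k<m) 2r≡1+q)

  ∨-falseˡ : ∀ {a b} → a ∨ b ≡ false → a ≡ false
  ∨-falseˡ {false} _ = refl

  ∨-falseʳ : ∀ {a b} → a ∨ b ≡ false → b ≡ false
  ∨-falseʳ {false} e = e

  column-empty : ∀ {k} → k < m → T k 1 ≡ false
  column-empty {zero}  _   = ∨-falseˡ (pair-empty m≥2)
  column-empty {suc k} k<m = ∨-falseʳ {T k 1} (pair-empty k<m)

  -- Column 1 exists: `suc q` equals `2 * r`, which is at least 2, so `q ≥ 1`.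
  1<n : 1 < suc (q * 2)
  1<n = s<s (≤-trans z<s (*-monoˡ-≤ 2 (s≤s⁻¹ (subst (2 ≤_) 2r≡1+q (*-monoʳ-≤ 2 r≥1)))))

  c≡0 : c ≡ 0
  c≡0 = trans (sym (Parks.columns P 1<n)) (trans (count-cong m column-empty) (count-none m))

-- Grids made of 2 × 2 boxes with one tree each

-- Describes occupancy: of two consecutive rows exactly one has a tree in a given column of boxes,
-- so occupancy flips from row to row, and likewise for columns.
alternate : Bool → ℕ → Bool
alternate b zero    = b
alternate b (suc k) = not (alternate b k)

alternate-even : ∀ b i → alternate b (i * 2) ≡ b
alternate-even b zero    = refl
alternate-even b (suc i) = trans (not-involutive _) (alternate-even b i)

-- α j says that the trees of the j-th column of boxes are in upper cells, and
-- β i that those of the i-th row of boxes are in left cells.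
boxed : (α β : ℕ → Bool) → ℕ → ℕ → Bool
boxed α β k l = alternate (α ⌊ l /2⌋) k ∧ alternate (β ⌊ k /2⌋) l

module _ (α β : ℕ → Bool) (i j : ℕ) where
  boxed-upper-left : boxed α β (i * 2) (j * 2) ≡ α j ∧ β i
  boxed-upper-left
    rewrite ⌊i*2/2⌋≡i i | ⌊i*2/2⌋≡i j | alternate-even (α j) i | alternate-even (β i) j = refl

  boxed-upper-right : boxed α β (i * 2) (suc (j * 2)) ≡ α j ∧ not (β i)
  boxed-upper-right
    rewrite ⌊i*2/2⌋≡i i | ⌊1+i*2/2⌋≡i j | alternate-even (α j) i | alternate-even (β i) j = refl

  boxed-lower-left : boxed α β (suc (i * 2)) (j * 2) ≡ not (α j) ∧ β i
  boxed-lower-left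
    rewrite ⌊1+i*2/2⌋≡i i | ⌊i*2/2⌋≡i j | alternate-even (α j) i | alternate-even (β i) j = refl

  boxed-lower-right : boxed α β (suc (i * 2)) (suc (j * 2)) ≡ not (α j) ∧ not (β i)
  boxed-lower-right
    rewrite ⌊1+i*2/2⌋≡i i | ⌊1+i*2/2⌋≡i j | alternate-even (α j) i | alternate-even (β i) j = refl

boxed-cong : ∀ {p q α α′ β β′} → (∀ {j} → j < q → α j ≡ α′ j) → (∀ {i} → i < p → β i ≡ β′ i) →
             ∀ {k l} → k < p * 2 → l < q * 2 → boxed α β k l ≡ boxed α′ β′ k l
boxed-cong eα eβ {k} {l} k< l< =
  cong₂ (λ a b → alternate a k ∧ alternate b l) (eα (⌊k/2⌋<p l<)) (eβ (⌊k/2⌋<p k<))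

-- In row `k` the two cells of a box have values `a ∧ b` and `a ∧ not b`, which together contribute
-- `⟦ a ⟧` whatever `b` is.
count-boxed : ∀ q α β k → count (q * 2) (boxed α β k) ≡ count q (λ j → alternate (α j) k)
count-boxed q α β k = lemma q α (β ⌊ k /2⌋)
  where
  pair : ∀ a b n → ⟦ a ∧ b ⟧ + (⟦ a ∧ not b ⟧ + n) ≡ ⟦ a ⟧ + n
  pair true  true  n = refl
  pair true  false n = refl
  pair false _     n = refl

  -- The value of `β` is generalised to a fixed `b`, so that the induction shifts only `α`; two
  -- steps along the row negate `b` twice.
  lemma : ∀ q α b → count (q * 2) (λ l → alternate (α ⌊ l /2⌋) k ∧ alternate b l)
                  ≡ count q (λ j → alternate (α j) k)
  lemma zero    α b = refl
  lemma (suc q) α b = trans (pair (alternate (α 0) k) b _)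
    (cong (⟦ alternate (α 0) k ⟧ +_) (trans
      (count-cong (q * 2) λ {l} _ → cong (alternate (α (suc ⌊ l /2⌋)) k ∧_) (not-involutive (alternate b l)))
      (lemma q (α ∘ suc) b)))

count-alternate : ∀ r α → count (2 * r) α ≡ r → ∀ k → count (2 * r) (λ j → alternate (α j) k) ≡ r
count-alternate r α e zero    = e
count-alternate r α e (suc k) = count-not-half (count-alternate r α e k)

-- Here `α` never rises and `β` never falls, so they share neither an ascent nor a descent. Squares
-- within a box or across one edge of it are separated by construction; monotonicity enters only
-- where four boxes meet.
boxed-parks : ∀ {c r α β} → count (2 * r) α ≡ r → count (2 * c) β ≡ c →
              (∀ j → not (α j) ∧ α (suc j) ≡ false) → (∀ i → β i ∧ not (β (suc i)) ≡ false) →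
              Parks c r (4 * c) (4 * r) (boxed α β)
boxed-parks {c} {r} {α} {β} eα eβ descα ascβ rewrite 4*n≡2*n*2 c | 4*n≡2*n*2 r = record
  { columns      = λ {l} _ → trans
      (count-cong (2 * c * 2) λ {k} _ → ∧-comm (alternate (α ⌊ l /2⌋) k) _)
      (trans (count-boxed (2 * c) β α l) (count-alternate c β eβ l))
  ; rows         = λ {k} _ → trans (count-boxed (2 * r) α β k) (count-alternate r α eα k)
  ; horizontal   = λ k l → ∧-false λ p q →
      clash (∧-trueʳ {alternate (α ⌊ l /2⌋) k} p) (∧-trueʳ {alternate (α ⌊ suc l /2⌋) k} q)
  ; vertical     = λ k l → ∧-false λ p q →
      clash (∧-trueˡ {alternate (α ⌊ l /2⌋) k} p) (∧-trueˡ q)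
  ; diagonal     = diagonal
  ; antidiagonal = antidiagonal
  }
  where
  clash : ∀ {a} → a ≡ true → not a ≢ true
  clash refl ()

  diagonal : ∀ k l → boxed α β k l ∧ boxed α β (suc k) (suc l) ≡ false
  diagonal k l with half k | half l
  ... | even i | even j rewrite boxed-upper-left α β i j | boxed-lower-right α β i j
    with α j | β i
  ...   | true  | true  = refl
  ...   | true  | false = refl
  ...   | false | _     = refl
  diagonal k l | even i | odd j rewrite boxed-upper-right α β i j | boxed-lower-left α β i (suc j)
    with α j | α (suc j) | β i
  ...   | true  | true  | true  = refl
  ...   | true  | true  | false = refl
  ...   | true  | false | true  = refl
  ...   | true  | false | false = refl
  ...   | false | _     | _     = refl
  diagonal k l | odd i | even j rewrite boxed-lower-left α β i j | boxed-upper-right α β (suc i) j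
    with α j | β i
  ...   | true  | _     = refl
  ...   | false | true  = refl
  ...   | false | false = refl
  -- Trees in both squares would make `α` rise at `j`.
  diagonal k l | odd i | odd j rewrite boxed-lower-right α β i j | boxed-upper-left α β (suc i) (suc j)
    with α j | α (suc j) | β i | descα j
  ...   | true  | _     | _     | _ = refl
  ...   | false | false | true  | _ = refl
  ...   | false | false | false | _ = refl

  antidiagonal : ∀ k l → boxed α β k (suc l) ∧ boxed α β (suc k) l ≡ false
  antidiagonal k l with half k | half l
  ... | even i | even j rewrite boxed-upper-right α β i j | boxed-lower-left α β i j
    with α j | β i
  ...   | true  | true  = refl
  ...   | true  | false = refl
  ...   | false | _     = refl
  antidiagonal k l | even i | odd j rewrite boxed-upper-left α β i (suc j) | boxed-lower-right α β i j
    with α (suc j) | α j | β i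
  ...   | false | _     | _     = refl
  ...   | true  | _     | false = refl
  ...   | true  | true  | true  = refl
  ...   | true  | false | true  = refl
  antidiagonal k l | odd i | even j rewrite boxed-lower-right α β i j | boxed-upper-left α β (suc i) j
    with α j | β i
  ...   | true  | _     = refl
  ...   | false | true  = refl
  ...   | false | false = refl
  -- Trees in both squares would make `β` fall at `i`.
  antidiagonal k l | odd i | odd j rewrite boxed-lower-left α β i (suc j) | boxed-upper-right α β (suc i) j
    with α (suc j) | α j | β i | β (suc i) | ascβ i
  ...   | true  | _     | _     | _     | _ = refl
  ...   | false | _     | false | _     | _ = refl
  ...   | false | true  | true  | true  | _ = refl
  ...   | false | false | true  | true  | _ = refl

-- Box form of a valid grid

box-alternates : ∀ {c r m T} → Parks c r m (2 * r * 2) T → ∀ {j} → j < 2 * r → ∀ {k} → k < m →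
  T k (j * 2) ∨ T k (suc (j * 2)) ≡ alternate (T 0 (j * 2) ∨ T 0 (suc (j * 2))) k
box-alternates P j< {zero} k<m = refl
box-alternates {r = r} {T = T} P {j} j< {suc k} k<m =
  trans flip (cong not (box-alternates P j< (<-trans (n<1+n k) k<m)))
  where
  open Parks P
  l : ℕ
  l = j * 2

  -- The 2 × 2 window has at most one tree by non-adjacency and at least one because the count for
  -- rows `k` and `suc k` is tight.
  flip : T (suc k) l ∨ T (suc k) (suc l) ≡ not (T k l ∨ T k (suc l))
  flip with T k l | T k (suc l) | T (suc k) l | T (suc k) (suc l)
          | vertical k l | vertical k (suc l) | diagonal k l | antidiagonal k l
          | count-sparse-tight (2 * r) {rowPair P k} (rowPair-sparse P k) (rowPair-count P k<m) j<
  ... | true  | _     | false | false | _ | _ | _ | _ | _ = refl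
  ... | false | true  | false | false | _ | _ | _ | _ | _ = refl
  ... | false | false | true  | _     | _ | _ | _ | _ | _ = refl
  ... | false | false | false | true  | _ | _ | _ | _ | _ = refl

record Boxed (c r : ℕ) (T : ℕ → ℕ → Bool) : Set where
  field
    α β         : ℕ → Bool
    balanced-α  : count (2 * r) α ≡ r
    balanced-β  : count (2 * c) β ≡ c
    agrees      : ∀ {k l} → k < 2 * c * 2 → l < 2 * r * 2 → T k l ≡ boxed α β k l
    no-descents : Descent (2 * r) α → ¬ Descent (2 * c) β
    no-ascents  : Descent (2 * r) (not ∘ α) → ¬ Descent (2 * c) (not ∘ β)

parks⇒boxed : ∀ {c r T} → 1 ≤ c → 1 ≤ r → Parks c r (2 * c * 2) (2 * r * 2) T → Boxed c r T
parks⇒boxed {c} {r} {T} c≥1 r≥1 P = record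
  { α = α ; β = β
  -- Row 0 holds `r` trees, one for each `true` value of `α`; column 0 does the same for `β`.
  ; balanced-α = trans (sym (count-boxed (2 * r) α β 0))
      (trans (sym (count-cong (2 * r * 2) (agrees (0< c≥1)))) (rows (0< c≥1)))
  ; balanced-β = trans (sym (count-boxed (2 * c) β α 0))
      (trans (sym (count-cong (2 * c * 2) λ {k} k< → trans (agrees k< (0< r≥1)) (∧-comm (alternate (α 0) k) _)))
             (columns (0< r≥1)))
  ; agrees = agrees
  -- These descents put trees into the lower left cell of box (i, j + 1) and the upper right cell of
  -- box (i + 1, j), which touch at a corner.
  ; no-descents = λ (j , j< , a , a′) (i , i< , b , b′) → not-both
      (antidiagonal (suc (i * 2)) (suc (j * 2)))
      (trans (agrees (1+i*2<p*2 (1+ i<)) (i*2<p*2 j<))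
        (trans (boxed-lower-left α β i (suc j)) (cong₂ (λ x y → not x ∧ y) a′ b)))
      (trans (agrees (i*2<p*2 i<) (1+i*2<p*2 (1+ j<)))
        (trans (boxed-upper-right α β (suc i) j) (cong₂ (λ x y → x ∧ not y) a b′)))
  -- Common ascents fill the lower right cell of box (i, j) and the upper left cell of box (i + 1, j
  -- + 1).
  ; no-ascents = λ (j , j< , a , a′) (i , i< , b , b′) → not-both
      (diagonal (suc (i * 2)) (suc (j * 2)))
      (trans (agrees (1+i*2<p*2 (1+ i<)) (1+i*2<p*2 (1+ j<)))
        (trans (boxed-lower-right α β i j) (cong₂ _∧_ a b)))
      (trans (agrees (i*2<p*2 i<) (i*2<p*2 j<))
        (trans (boxed-upper-left α β (suc i) (suc j)) (cong₂ _∧_ (not-false a′) (not-false b′))))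
  }
  where
  open Parks P

  -- `α` is read off the top row and `β` off the leftmost column; alternation carries them over the
  -- whole grid.
  α β : ℕ → Bool
  α j = T 0 (j * 2) ∨ T 0 (suc (j * 2))
  β i = T (i * 2) 0 ∨ T (suc (i * 2)) 0

  0< : ∀ {s} → 1 ≤ s → 0 < 2 * s * 2
  0< (s≤s _) = z<s

  1+ : ∀ {i n} → suc i < n → i < n
  1+ = <-trans (n<1+n _)

  not-false : ∀ {a} → not a ≡ false → a ≡ true
  not-false {true} _ = refl

  -- In a box with at most one tree the row and the column of the tree determine it.
  corner : ∀ {a b c x y} → b ∧ c ≡ false → a ∨ b ≡ x → a ∨ c ≡ y → a ≡ x ∧ y
  corner {true}                  _ refl refl = refl
  corner {false} {true}  {false} _ refl refl = refl
  corner {false} {false}         _ refl refl = refl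

  swap : ∀ {a b} → a ∧ b ≡ false → b ∧ a ≡ false
  swap {a} e = trans (∧-comm _ a) e

  ∨-swap : ∀ {a b x} → a ∨ b ≡ x → b ∨ a ≡ x
  ∨-swap {a} e = trans (∨-comm _ a) e

  -- `d` tells whether row `k`, and `e` whether column `l`, meets the box in a tree; `e` comes from
  -- the transposed grid. The horizontal and the vertical neighbour within the box are diagonal to
  -- each other, so `corner` applies.
  agrees : ∀ {k l} → k < 2 * c * 2 → l < 2 * r * 2 → T k l ≡ boxed α β k l
  agrees {k} {l} k< l< with half k | half l
     | box-alternates P (⌊k/2⌋<p l<) k< | box-alternates (transpose P) (⌊k/2⌋<p k<) l<
  ... | even i | even j | d | e rewrite ⌊i*2/2⌋≡i i | ⌊i*2/2⌋≡i j =
    corner (antidiagonal (i * 2) (j * 2)) d e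
  ... | even i | odd j | d | e rewrite ⌊i*2/2⌋≡i i | ⌊1+i*2/2⌋≡i j =
    corner (diagonal (i * 2) (j * 2)) (∨-swap {T (i * 2) (j * 2)} d) e
  ... | odd i | even j | d | e rewrite ⌊1+i*2/2⌋≡i i | ⌊i*2/2⌋≡i j =
    corner (swap {T (i * 2) (j * 2)} (diagonal (i * 2) (j * 2))) d (∨-swap {T (i * 2) (j * 2)} e)
  ... | odd i | odd j | d | e rewrite ⌊1+i*2/2⌋≡i i | ⌊1+i*2/2⌋≡i j =
    corner (swap {T (i * 2) (suc (j * 2))} (antidiagonal (i * 2) (j * 2)))
      (∨-swap {T (suc (i * 2)) (j * 2)} d) (∨-swap {T (i * 2) (suc (j * 2))} e)

-- The two pairs of step functions

shuriken₁ shuriken₂ : (c r : ℕ) → ℕ → ℕ → Bool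
shuriken₁ c r = boxed (_<ᵇ r) (not ∘ (_<ᵇ c))
shuriken₂ c r = boxed (not ∘ (_<ᵇ r)) (_<ᵇ c)

AgreeOn : (m n : ℕ) (S T : ℕ → ℕ → Bool) → Set
AgreeOn m n S T = ∀ {k l} → k < m → l < n → S k l ≡ T k l

descent-cong : ∀ {n f g} → (∀ {i} → i < n → f i ≡ g i) → Descent n f → Descent n g
descent-cong e (i , i< , p , q) =
  i , i< , trans (sym (e (<-trans (n<1+n i) i<))) p , trans (sym (e i<)) q

balanced-descent : ∀ {s} → 1 ≤ s → Descent (2 * s) (_<ᵇ s)
balanced-descent {s} s≥1 = <ᵇ-descent s (s + 0) s≥1 (≤-trans s≥1 (m≤m+n s 0))

not-flip : ∀ {a b} → a ≡ not b → not a ≡ b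
not-flip e = trans (cong not e) (not-involutive _)

-- If `α` has a descent, `β` has none and is the balanced ascending sequence. That sequence has an
-- ascent, so `α` has none and is the balanced descending one.
boxed⇒shuriken : ∀ {c r T} → 1 ≤ c → 1 ≤ r → Boxed c r T →
  AgreeOn (2 * c * 2) (2 * r * 2) T (shuriken₁ c r) ⊎ AgreeOn (2 * c * 2) (2 * r * 2) T (shuriken₂ c r)
boxed⇒shuriken {c} {r} {T} c≥1 r≥1 B with descent? (2 * r) (Boxed.α B)
... | inj₂ d = inj₁ λ k< l< → trans (Boxed.agrees B k< l<) (boxed-cong α≡ β≡ k< l<)
  where
  open Boxed B

  β≡ : ∀ {i} → i < 2 * c → β i ≡ not (i <ᵇ c)
  β≡ = balanced-ascending c (no-descent⇒ascending (no-descents d)) balanced-β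

  α≡ : ∀ {j} → j < 2 * r → α j ≡ (j <ᵇ r)
  α≡ j< = trans (sym (not-involutive _)) (not-flip
    (balanced-ascending r
      (no-descent⇒ascending λ d′ → no-ascents d′ (descent-cong (sym ∘ not-flip ∘ β≡) (balanced-descent c≥1)))
      (count-not-half balanced-α) j<))
-- Otherwise `α` is the balanced ascending sequence, and its ascent forbids ascents of `β`.
... | inj₁ a = inj₂ λ k< l< → trans (Boxed.agrees B k< l<) (boxed-cong α≡ β≡ k< l<)
  where
  open Boxed B

  α≡ : ∀ {j} → j < 2 * r → α j ≡ not (j <ᵇ r)
  α≡ = balanced-ascending r a balanced-α

  β≡ : ∀ {i} → i < 2 * c → β i ≡ (i <ᵇ c)
  β≡ i< = trans (sym (not-involutive _)) (not-flip
    (balanced-ascending c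
      (no-descent⇒ascending (no-ascents (descent-cong (sym ∘ not-flip ∘ α≡) (balanced-descent r≥1))))
      (count-not-half balanced-β) i<))

-- Configurations as grids

-- Squares outside the configuration are empty, so that the non-adjacency
-- conditions need no bounds.
entry : ∀ {n} → Subset n → ℕ → Bool
entry []      _       = false
entry (x ∷ _) zero    = x
entry (_ ∷ p) (suc l) = entry p l

cell : ∀ {m n} → Configuration m n → ℕ → ℕ → Bool
cell []      _       _ = false
cell (R ∷ _) zero    l = entry R l
cell (_ ∷ A) (suc k) l = cell A k l

entry-lookup : ∀ {n} (p : Subset n) i → lookup p i ≡ entry p (toℕ i)
entry-lookup (_ ∷ _) zero    = refl
entry-lookup (_ ∷ p) (suc i) = entry-lookup p i

cell-lookup : ∀ {m n} (A : Configuration m n) k l → lookup (row A k) l ≡ cell A (toℕ k) (toℕ l)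
cell-lookup (R ∷ _) zero    l = entry-lookup R l
cell-lookup (_ ∷ A) (suc k) l = cell-lookup A k l

entry-member : ∀ {n} (p : Subset n) {l} → entry p l ≡ true → ∃[ i ] (toℕ i ≡ l × i ∈ p)
entry-member (_ ∷ p) {zero}  e = zero , refl , lookup⇒[]= zero _ e
entry-member (_ ∷ p) {suc l} e with entry-member p e
... | i , refl , i∈p = suc i , refl , there i∈p

-- Cells outside the grid are `false`, so a `true` value itself yields the bounds on its indices.
cell-tree : ∀ {m n} (A : Configuration m n) {k l} → cell A k l ≡ true →
            ∃[ k′ ] ∃[ l′ ] (toℕ k′ ≡ k × toℕ l′ ≡ l × Tree A k′ l′)
cell-tree (R ∷ _) {zero}  e with entry-member R e
... | i , eq , i∈R = zero , i , refl , eq , i∈R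
cell-tree (_ ∷ A) {suc k} e with cell-tree A e
... | k′ , l′ , refl , eq , t = suc k′ , l′ , refl , eq , t

-- Any `f` agreeing with `p` is allowed, so that rows, columns and reflected columns are all
-- covered.
∣p∣≡count : ∀ {n} (p : Subset n) {f} → (∀ i → lookup p i ≡ f (toℕ i)) → ∣ p ∣ ≡ count n f
∣p∣≡count []          e = refl
∣p∣≡count (true  ∷ p) e rewrite sym (e zero) = cong suc (∣p∣≡count p (e ∘ suc))
∣p∣≡count (false ∷ p) e rewrite sym (e zero) = ∣p∣≡count p (e ∘ suc)

∣n-1+n∣≡1 : ∀ n → ∣ n - suc n ∣ ≡ 1
∣n-1+n∣≡1 zero    = refl
∣n-1+n∣≡1 (suc n) = ∣n-1+n∣≡1 n

∣m-n∣≡1⇒consecutive : ∀ m n → ∣ m - n ∣ ≡ 1 → n ≡ suc m ⊎ m ≡ suc n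
∣m-n∣≡1⇒consecutive zero    n       e = inj₁ e
∣m-n∣≡1⇒consecutive (suc m) zero    e = inj₂ e
∣m-n∣≡1⇒consecutive (suc m) (suc n) e with ∣m-n∣≡1⇒consecutive m n e
... | inj₁ p = inj₁ (cong suc p)
... | inj₂ p = inj₂ (cong suc p)

valid⇒parks : ∀ {c r m n} {A : Configuration m n} → Valid c r A → Parks c r m n (cell A)
valid⇒parks {A = A} V = record
  { columns = λ l<n → trans (sym (∣p∣≡count (column A (fromℕ< l<n)) λ k →
      trans (lookup-map k _ A) (trans (cell-lookup A k _) (cong (cell A (toℕ k)) (toℕ-fromℕ< l<n)))))
      (columns (fromℕ< l<n))
  ; rows = λ k<m → trans (sym (∣p∣≡count (row A (fromℕ< k<m)) λ l →
      trans (cell-lookup A _ l) (cong (λ k → cell A k (toℕ l)) (toℕ-fromℕ< k<m))))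
      (rows (fromℕ< k<m))
  ; horizontal = λ k l → ∧-false (exclude λ { ek refl ek′ el′ →
      horizontally (toℕ-injective (trans ek (sym ek′))) (consecutive el′) })
  ; vertical = λ k l → ∧-false (exclude λ { refl el ek′ el′ →
      vertically (consecutive ek′) (toℕ-injective (trans el (sym el′))) })
  ; diagonal = λ k l → ∧-false (exclude λ { refl refl ek′ el′ →
      diagonally (consecutive ek′) (consecutive el′) })
  ; antidiagonal = λ k l → ∧-false (exclude λ { {l′ = l′} refl el ek′ refl →
      diagonally (consecutive ek′) (trans (∣-∣-comm _ (toℕ l′)) (consecutive el)) })
  }
  where
  open Valid V

  consecutive : ∀ {a b} → b ≡ suc a → ∣ a - b ∣ ≡ 1
  consecutive {a} refl = ∣n-1+n∣≡1 a

  exclude : ∀ {x y x′ y′} →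
    (∀ {k l k′ l′} → toℕ k ≡ x → toℕ l ≡ y → toℕ k′ ≡ x′ → toℕ l′ ≡ y′ → Adjacent k l k′ l′) →
    cell A x y ≡ true → cell A x′ y′ ≢ true
  exclude adj e e′ with cell-tree A e | cell-tree A e′
  ... | _ , _ , ek , el , t | _ , _ , ek′ , el′ , t′ = nonAdjacent t t′ (adj ek el ek′ el′)

parks⇒valid : ∀ {c r m n T} {A : Configuration m n} →
  (∀ k l → lookup (row A k) l ≡ T (toℕ k) (toℕ l)) → Parks c r m n T → Valid c r A
parks⇒valid {T = T} {A} e P = record
  { columns = λ l → trans (∣p∣≡count (column A l) λ k → trans (lookup-map k _ A) (e k l)) (columns (toℕ<n l))
  ; rows = λ k → trans (∣p∣≡count (row A k) (e k)) (rows (toℕ<n k))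
  ; nonAdjacent = λ t t′ → separated (tree t) (tree t′)
  }
  where
  open Parks P

  tree : ∀ {k l} → Tree A k l → T (toℕ k) (toℕ l) ≡ true
  tree {k} {l} t = trans (sym (e k l)) ([]=⇒lookup t)

  -- `Adjacent` covers eight neighbours, the grid conditions four directions; the opposite four
  -- follow by exchanging the two trees.
  separated : ∀ {k l k′ l′} → T (toℕ k) (toℕ l) ≡ true → T (toℕ k′) (toℕ l′) ≡ true →
              ¬ Adjacent k l k′ l′
  separated {k} {l} {_} {l′} t t′ (horizontally refl dl)
    with ∣m-n∣≡1⇒consecutive (toℕ l) (toℕ l′) dl
  ... | inj₁ el rewrite el = not-both (horizontal (toℕ k) (toℕ l)) t t′
  ... | inj₂ el rewrite el = not-both (horizontal (toℕ k) (toℕ l′)) t′ t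
  separated {k} {l} {k′} t t′ (vertically dk refl)
    with ∣m-n∣≡1⇒consecutive (toℕ k) (toℕ k′) dk
  ... | inj₁ ek rewrite ek = not-both (vertical (toℕ k) (toℕ l)) t t′
  ... | inj₂ ek rewrite ek = not-both (vertical (toℕ k′) (toℕ l)) t′ t
  separated {k} {l} {k′} {l′} t t′ (diagonally dk dl)
    with ∣m-n∣≡1⇒consecutive (toℕ k) (toℕ k′) dk | ∣m-n∣≡1⇒consecutive (toℕ l) (toℕ l′) dl
  ... | inj₁ ek | inj₁ el rewrite ek | el = not-both (diagonal (toℕ k) (toℕ l)) t t′
  ... | inj₁ ek | inj₂ el rewrite ek | el = not-both (antidiagonal (toℕ k) (toℕ l′)) t t′
  ... | inj₂ ek | inj₁ el rewrite ek | el = not-both (antidiagonal (toℕ k′) (toℕ l)) t′ t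
  ... | inj₂ ek | inj₂ el rewrite ek | el = not-both (diagonal (toℕ k′) (toℕ l′)) t′ t

-- Reflection of the rows

∣m∸a-m∸b∣≡∣a-b∣ : ∀ {m a b} → a ≤ m → b ≤ m → ∣ m ∸ a - m ∸ b ∣ ≡ ∣ a - b ∣
∣m∸a-m∸b∣≡∣a-b∣ {m} {b = b} z≤n b≤m =
  trans (m≤n⇒∣n-m∣≡n∸m (m∸n≤m m b)) (m∸[m∸n]≡n b≤m)
∣m∸a-m∸b∣≡∣a-b∣ {m} {a} a≤m@(s≤s _) z≤n =
  trans (m≤n⇒∣m-n∣≡n∸m (m∸n≤m m a)) (m∸[m∸n]≡n a≤m)
∣m∸a-m∸b∣≡∣a-b∣ (s≤s a≤m) (s≤s b≤m) = ∣m∸a-m∸b∣≡∣a-b∣ a≤m b≤m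

∣opposite-opposite∣ : ∀ {m} (k k′ : Fin m) →
  ∣ toℕ (opposite k) - toℕ (opposite k′) ∣ ≡ ∣ toℕ k - toℕ k′ ∣
∣opposite-opposite∣ k k′ rewrite opposite-prop k | opposite-prop k′ =
  ∣m∸a-m∸b∣≡∣a-b∣ (toℕ<n k) (toℕ<n k′)

lookup-reflectRows : ∀ {m n} (A : Configuration m n) k l →
  lookup (row (reflectRows A) k) l ≡ cell A (m ∸ suc (toℕ k)) (toℕ l)
lookup-reflectRows {m} A k l = begin
  lookup (row (reflectRows A) k) l       ≡⟨ cong (λ R → lookup R l) (lookup∘tabulate _ k) ⟩
  lookup (row A (opposite k)) l          ≡⟨ cell-lookup A (opposite k) l ⟩
  cell A (toℕ (opposite k)) (toℕ l)      ≡⟨ cong (λ x → cell A x (toℕ l)) (opposite-prop k) ⟩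
  cell A (m ∸ suc (toℕ k)) (toℕ l)       ∎
  where open ≡-Reasoning

-- Columns are read backwards, rows are permuted, and `opposite` preserves distances between row
-- indices.
reflectRows-valid : ∀ {c r m n} {A : Configuration m n} → Valid c r A → Valid c r (reflectRows A)
reflectRows-valid {m = m} {A = A} V = record
  { columns = λ l → begin
      ∣ column (reflectRows A) l ∣
        ≡⟨ ∣p∣≡count (column (reflectRows A) l) {λ k → cell A (m ∸ suc k) (toℕ l)}
             (λ k → trans (lookup-map k _ (reflectRows A)) (lookup-reflectRows A k l)) ⟩
      count m (λ k → cell A (m ∸ suc k) (toℕ l))
        ≡⟨ count-reverse m (λ k → cell A k (toℕ l)) ⟩
      count m (λ k → cell A k (toℕ l))
        ≡⟨ Parks.columns (valid⇒parks V) (toℕ<n l) ⟩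
      _ ∎
  ; rows = λ k → trans (cong ∣_∣ (lookup∘tabulate _ k)) (rows (opposite k))
  ; nonAdjacent = λ t t′ a → nonAdjacent (reflect t) (reflect t′) (reflect-adjacent a)
  }
  where
  open ≡-Reasoning
  open Valid V

  reflect : ∀ {k l} → Tree (reflectRows A) k l → Tree A (opposite k) l
  reflect {k} {l} = subst (l ∈_) (lookup∘tabulate _ k)

  reflect-adjacent : ∀ {k l k′ l′} → Adjacent k l k′ l′ → Adjacent (opposite k) l (opposite k′) l′
  reflect-adjacent           (horizontally ek dl) = horizontally (cong opposite ek) dl
  reflect-adjacent {k} {_} {k′} (vertically dk el) = vertically (trans (∣opposite-opposite∣ k k′) dk) el
  reflect-adjacent {k} {_} {k′} (diagonally dk dl) = diagonally (trans (∣opposite-opposite∣ k k′) dk) dl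

configuration-ext : ∀ {m n} {A B : Configuration m n} →
  (∀ k l → lookup (row A k) l ≡ lookup (row B k) l) → A ≡ B
configuration-ext e = vec-ext (vec-ext ∘ e)
  where
  vec-ext : ∀ {X : Set} {n} {xs ys : Vec X n} → (∀ i → lookup xs i ≡ lookup ys i) → xs ≡ ys
  vec-ext {xs = xs} {ys} e =
    trans (sym (tabulate∘lookup xs)) (trans (tabulate-cong e) (tabulate∘lookup ys))

draw : ∀ m n → (ℕ → ℕ → Bool) → Configuration m n
draw m n T = tabulate λ k → tabulate λ l → T (toℕ k) (toℕ l)

lookup-draw : ∀ {m n} T k l → lookup (row (draw m n T) k) l ≡ T (toℕ k) (toℕ l)
lookup-draw T k l = trans (cong (λ R → lookup R l) (lookup∘tabulate _ k)) (lookup∘tabulate _ l)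

cell-agrees⇒≡draw : ∀ {m n} {A : Configuration m n} {T} → AgreeOn m n (cell A) T → A ≡ draw m n T
cell-agrees⇒≡draw {A = A} {T} e = configuration-ext λ k l →
  trans (cell-lookup A k l) (trans (e (toℕ<n k) (toℕ<n l)) (sym (lookup-draw T k l)))

-- The Shuriken arrangements

-- The step function for `r` never rises and the negated one for `c` never falls; both reduce to
-- `step`.
shuriken₁-parks : ∀ c r → Parks c r (4 * c) (4 * r) (shuriken₁ c r)
shuriken₁-parks c r = boxed-parks (count-<ᵇ r (r + 0)) (count-not-half (count-<ᵇ c (c + 0)))
  (step r) (λ i → trans (cong (not (i <ᵇ c) ∧_) (not-involutive (suc i <ᵇ c))) (step c i))
  where
  step : ∀ s j → not (j <ᵇ s) ∧ (suc j <ᵇ s) ≡ false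
  step zero    zero    = refl
  step zero    (suc j) = refl
  step (suc s) zero    = refl
  step (suc s) (suc j) = step s j

-- The second arrangement appears here through its own step functions; `only-shurikens` identifies
-- it with the reflection.
classification : ∀ {c r} → 1 ≤ c → 1 ≤ r → ∀ B → Valid c r B →
  B ≡ draw (4 * c) (4 * r) (shuriken₁ c r) ⊎ B ≡ draw (4 * c) (4 * r) (shuriken₂ c r)
classification {c} {r} c≥1 r≥1 B V
  with boxed⇒shuriken c≥1 r≥1 (parks⇒boxed c≥1 r≥1
         (subst₂ (λ m n → Parks c r m n (cell B)) (4*n≡2*n*2 c) (4*n≡2*n*2 r) (valid⇒parks V)))
... | inj₁ e = inj₁ (cell-agrees⇒≡draw λ k< l< → e (<-4*⇒<-2*2 c k<) (<-4*⇒<-2*2 r l<))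
... | inj₂ e = inj₂ (cell-agrees⇒≡draw λ k< l< → e (<-4*⇒<-2*2 c k<) (<-4*⇒<-2*2 r l<))

-- Box indices start at 0 here and at 1 in the statement, whence `suc i`; the even 0-based index
-- `i * 2` is an odd 1-based one.
odd-index : ∀ i → suc (i * 2) ≡ 2 * suc i ∸ 1
odd-index i = cong (_∸ 1) (*-comm (suc i) 2)

even-index : ∀ i → suc (suc (i * 2)) ≡ 2 * suc i
even-index i = *-comm (suc i) 2

shuriken₁⇒square : ∀ {c r k l} → k < 4 * c → l < 4 * r →
                   shuriken₁ c r k l ≡ true → ShurikenSquare c r (suc k) (suc l)
shuriken₁⇒square {c} {r} {k} {l} k< l<
  with half k | half l
     | ⌊k/2⌋<p {p = 2 * c} (<-4*⇒<-2*2 c k<) | ⌊k/2⌋<p {p = 2 * r} (<-4*⇒<-2*2 r l<)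
-- The position in the box tells the quadrant: upper left cells carry trees only where `j < r` and
-- `c ≤ i`. The bounds on the halved indices give the outer limits `2 * c` and `2 * r`.
... | even i | even j | i< | j< rewrite boxed-upper-left (_<ᵇ r) (not ∘ (_<ᵇ c)) i j | ⌊i*2/2⌋≡i i | ⌊i*2/2⌋≡i j =
  λ e → lowerLeft (suc i) (suc j)
    (s≤s (<ᵇ-false⇒≤ i c (not-true (∧-trueʳ {j <ᵇ r} e)))) i< z<s (<ᵇ-true⇒< j r (∧-trueˡ e))
    (odd-index i) (odd-index j)
... | even i | odd j | i< | j< rewrite boxed-upper-right (_<ᵇ r) (not ∘ (_<ᵇ c)) i j | not-involutive (i <ᵇ c) =
  λ e → upperLeft (suc i) (suc j)
    z<s (<ᵇ-true⇒< i c (∧-trueʳ {j <ᵇ r} e)) z<s (<ᵇ-true⇒< j r (∧-trueˡ e))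
    (odd-index i) (even-index j)
... | odd i | even j | i< | j< rewrite boxed-lower-left (_<ᵇ r) (not ∘ (_<ᵇ c)) i j | ⌊1+i*2/2⌋≡i i | ⌊i*2/2⌋≡i j =
  λ e → lowerRight (suc i) (suc j)
    (s≤s (<ᵇ-false⇒≤ i c (not-true (∧-trueʳ {not (j <ᵇ r)} e)))) i<
    (s≤s (<ᵇ-false⇒≤ j r (not-true (∧-trueˡ e)))) j<
    (even-index i) (odd-index j)
... | odd i | odd j | i< | j< rewrite boxed-lower-right (_<ᵇ r) (not ∘ (_<ᵇ c)) i j | not-involutive (i <ᵇ c) | ⌊1+i*2/2⌋≡i j =
  λ e → upperRight (suc i) (suc j)
    z<s (<ᵇ-true⇒< i c (∧-trueʳ {not (j <ᵇ r)} e))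
    (s≤s (<ᵇ-false⇒≤ j r (not-true (∧-trueˡ e)))) j<
    (even-index i) (even-index j)

square⇒shuriken₁ : ∀ {c r k l} → ShurikenSquare c r (suc k) (suc l) → shuriken₁ c r k l ≡ true
square⇒shuriken₁ {c} {r} (upperLeft (suc i) (suc j) _ i≤ _ j≤ ek el)
  rewrite suc-injective (trans ek (sym (odd-index i))) | suc-injective (trans el (sym (even-index j)))
        | boxed-upper-right (_<ᵇ r) (not ∘ (_<ᵇ c)) i j | <⇒<ᵇ-true i≤ | <⇒<ᵇ-true j≤ = refl
square⇒shuriken₁ {c} {r} (upperRight (suc i) (suc j) _ i≤ (s≤s r≤) _ ek el)
  rewrite suc-injective (trans ek (sym (even-index i))) | suc-injective (trans el (sym (even-index j)))
        | boxed-lower-right (_<ᵇ r) (not ∘ (_<ᵇ c)) i j | <⇒<ᵇ-true i≤ | ≤⇒<ᵇ-false r≤ = refl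
square⇒shuriken₁ {c} {r} (lowerLeft (suc i) (suc j) (s≤s c≤) _ _ j≤ ek el)
  rewrite suc-injective (trans ek (sym (odd-index i))) | suc-injective (trans el (sym (odd-index j)))
        | boxed-upper-left (_<ᵇ r) (not ∘ (_<ᵇ c)) i j | ≤⇒<ᵇ-false c≤ | <⇒<ᵇ-true j≤ = refl
square⇒shuriken₁ {c} {r} (lowerRight (suc i) (suc j) (s≤s c≤) _ (s≤s r≤) _ ek el)
  rewrite suc-injective (trans ek (sym (even-index i))) | suc-injective (trans el (sym (odd-index j)))
        | boxed-lower-left (_<ᵇ r) (not ∘ (_<ᵇ c)) i j | ≤⇒<ᵇ-false c≤ | ≤⇒<ᵇ-false r≤ = refl

module _ (c r : ℕ) where
  firstShuriken : Configuration (4 * c) (4 * r)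
  firstShuriken = draw (4 * c) (4 * r) (shuriken₁ c r)

  firstShuriken-isFirst : IsFirstShuriken c r firstShuriken
  firstShuriken-isFirst k l = mk⇔
    (λ t → shuriken₁⇒square (toℕ<n k) (toℕ<n l)
             (trans (sym (lookup-draw (shuriken₁ c r) k l)) ([]=⇒lookup t)))
    (λ s → lookup⇒[]= l _ (trans (lookup-draw (shuriken₁ c r) k l) (square⇒shuriken₁ s)))

  firstShuriken-valid : Valid c r firstShuriken
  firstShuriken-valid = parks⇒valid (lookup-draw (shuriken₁ c r)) (shuriken₁-parks c r)

-- The top left corner box has its tree in the top right cell, while the bottom
-- left corner box has it in its upper row, so that cell is not a tree after reflection.
firstShuriken-asymmetric : ∀ c r → 1 ≤ c → 1 ≤ r → firstShuriken c r ≢ reflectRows (firstShuriken c r)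
firstShuriken-asymmetric (suc c) (suc r) _ _ A≡A′ =
  contradiction (∧-trueˡ {alternate true (4 * suc c ∸ 1)} (begin
    S (4 * suc c ∸ 1) 1                    ≡⟨ cong₂ S (sym (opposite-prop k)) (sym toℕl≡1) ⟩
    S (toℕ (opposite k)) (toℕ l)           ≡⟨ sym (lookup-draw S (opposite k) l) ⟩
    lookup (row A (opposite k)) l          ≡⟨ cong (λ R → lookup R l) (sym (lookup∘tabulate (row A ∘ opposite) k)) ⟩
    lookup (row (reflectRows A) k) l       ≡⟨ cong (λ X → lookup (row X k) l) (sym A≡A′) ⟩
    lookup (row A k) l                     ≡⟨ lookup-draw S k l ⟩
    S 0 (toℕ l)                            ≡⟨ cong (S 0) toℕl≡1 ⟩
    true                                   ∎)) bottom
  where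
  open ≡-Reasoning
  A = firstShuriken (suc c) (suc r)
  S = shuriken₁ (suc c) (suc r)

  1<4r : 1 < 4 * suc r
  1<4r = ≤-trans (s≤s (s≤s z≤n)) (*-monoʳ-≤ 4 {1} (s≤s z≤n))

  k : Fin (4 * suc c)
  k = zero

  l : Fin (4 * suc r)
  l = fromℕ< 1<4r

  toℕl≡1 : toℕ l ≡ 1
  toℕl≡1 = toℕ-fromℕ< 1<4r

  -- At the even number `4 * suc c` the alternation is back at `true`, so one step earlier it is
  -- `false`.
  bottom : alternate true (4 * suc c ∸ 1) ≢ true
  bottom e = contradiction
    (trans (sym (trans (cong (alternate true) (4*n≡2*n*2 (suc c))) (alternate-even true (2 * suc c)))) (cong not e))
    λ ()

-- Size bounds, the single square and uniqueness

module _ {c r : ℕ} (c≥1 : 1 ≤ c) (r≥1 : 1 ≤ r) where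
  -- By `single-row` a grid with one row or one column is a single square; excluding that leaves
  -- both sides at least 2, as `width-bound` requires.
  size-bounds : ∀ {m n} {A : Configuration m n} → 1 ≤ m → 1 ≤ n → (m , n) ≢ (1 , 1) →
                Valid c r A → m ≥ 4 * c × n ≥ 4 * r
  size-bounds {m} {n} m≥1 n≥1 ≢1 V =
    width-bound (transpose P) r≥1 c≥1 (two n≥1 λ n≡1 → ≢1 (cong₂ _,_ (≤-antisym (single-row (transpose P) r≥1 n≡1) m≥1) n≡1)) ,
    width-bound P c≥1 r≥1 (two m≥1 λ m≡1 → ≢1 (cong₂ _,_ m≡1 (≤-antisym (single-row P c≥1 m≡1) n≥1)))
    where
    P = valid⇒parks V

    two : ∀ {x} → 1 ≤ x → x ≢ 1 → 2 ≤ x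
    two p ne = ≤∧≢⇒< p (ne ∘ sym)

  single-square : (∃[ A ] Valid c r {1} {1} A) ⇔ (c ≡ 1 × r ≡ 1)
  single-square = mk⇔ (λ (A , V) → to A V) from
    where
    to : (A : Configuration 1 1) → Valid c r A → c ≡ 1 × r ≡ 1
    to ((true  ∷ []) ∷ []) V = sym (Valid.columns V zero) , sym (Valid.rows V zero)
    to ((false ∷ []) ∷ []) V = contradiction (≤-trans c≥1 (≤-reflexive (sym (Valid.columns V zero)))) λ ()

    from : c ≡ 1 × r ≡ 1 → ∃[ A ] Valid c r {1} {1} A
    from (refl , refl) = (true ∷ []) ∷ [] , record
      { columns = λ { zero → refl }
      ; rows = λ { zero → refl }
      ; nonAdjacent = λ { {zero} {zero} {zero} {zero} _ _ (horizontally _ ())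
                        ; {zero} {zero} {zero} {zero} _ _ (vertically () _)
                        ; {zero} {zero} {zero} {zero} _ _ (diagonally () _) }
      }

  -- The reflection is valid and differs from firstShuriken, so it must be the
  -- second arrangement of the classification.
  only-shurikens : ∀ B → Valid c r B → B ≡ firstShuriken c r ⊎ B ≡ reflectRows (firstShuriken c r)
  only-shurikens B V with classification c≥1 r≥1 B V
       | classification c≥1 r≥1 _ (reflectRows-valid (firstShuriken-valid c r))
  ... | inj₁ e | _       = inj₁ e
  ... | inj₂ e | inj₁ e′ = contradiction (sym e′) (firstShuriken-asymmetric c r c≥1 r≥1)
  ... | inj₂ e | inj₂ e′ = inj₂ (trans e (sym e′))

theorem2 : (c r : ℕ) → 1 ≤ c → 1 ≤ r →
    ((m n : ℕ) → 1 ≤ m → 1 ≤ n → (m , n) ≢ (1 , 1) →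
    (∃[ A ] Valid c r {m} {n} A) → m ≥ 4 * c × n ≥ 4 * r)
    × ((∃[ A ] Valid c r {1} {1} A) ⇔ (c ≡ 1 × r ≡ 1))
    × (∃[ A ] (IsFirstShuriken c r A
    × Valid c r A
    × Valid c r (reflectRows A)
    × A ≢ reflectRows A
    × (∀ B → Valid c r B → B ≡ A ⊎ B ≡ reflectRows A)))
theorem2 c r c≥1 r≥1 =
    (λ m n m≥1 n≥1 ≢1 (_ , V) → size-bounds c≥1 r≥1 m≥1 n≥1 ≢1 V)
  , single-square c≥1 r≥1
  , firstShuriken c r
  , firstShuriken-isFirst c r
  , firstShuriken-valid c r
  , reflectRows-valid (firstShuriken-valid c r)
  , firstShuriken-asymmetric c r c≥1 r≥1
  , only-shurikens c≥1 r≥1
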